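{- The pots $$P_1=\big\{\{1,1,1\},\{2,2,2\},\{ -2,-3,-3\},\{ -1,-4,-4\},\{ -1,3,-5\},\{ -2,4,5\}\big\}$$ and $$P_2=\big\{\{1,1,1\},\{2,2,2\},\{ -2,-3,-3\},\{ -1,-4,-4\},\{3,4,5\},\{ -1,-2,-5\}\big\}$$ (inner braces denoting multisets) are non-isomorphic pots.
   Context: A tile is a finite multiset of integers; a pot is a set of tiles. $\Sigma(P)$ is the set of positive integers (colors) appearing in some tile of the pot $P$. Two pots $P,P'$ are isomorphic if there is a bijection $f:\pm\Sigma(P)\to\pm\Sigma(P')$, where $\pm X=X\cup(-X)$, with $f(-i)=-f(i)$ for all $i$ and $f(P)=P'$, where $f$ is applied elementwise (with multiplicity) to tiles and to each tile of a pot. -}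

module Defs where

open import Agda.Builtin.FromNat using (Number; fromNat)
open import Agda.Builtin.FromNeg using (Negative; fromNeg)
open import Data.Integer.Base using (ℤ; -_; Positive)
open import Data.Integer.Properties using (neg-involutive)
import Data.Integer.Literals as ℤ
open import Data.List.Base using (List; []; _∷_; map)
open import Data.List.Membership.Propositional using (_∈_)
open import Data.List.Relation.Binary.Permutation.Propositional using (_↭_)
open import Data.List.Relation.Unary.Any using (Any)
open import Data.Product.Base using (Σ; ∃; _×_)
open import Data.Refinement as Refinement using (Refinement; value)
open import Data.Sum.Base using (_⊎_; inj₁; inj₂)
open import Data.Unit.Base using (⊤; tt)
open import Function.Bundles using (_⤖_; module Bijection)
open import Relation.Binary.PropositionalEquality using (_≡_; sym; subst)

-- A multiset is represented by any list enumerating it, so equality of tiles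
-- is _↭_ and never _≡_.
Tile : Set
Tile = List ℤ

-- A finite set of tiles; order and repetition in the list are immaterial.
Pot : Set
Pot = List Tile

infix 4 _∈ᵖ_ _∈Σ_ _∈±Σ_ _≅_

_∈ᵖ_ : Tile → Pot → Set
t ∈ᵖ P = Any (t ↭_) P

-- i ∈Σ P : the positive integer i is a color of P. A color appears in a tile
-- with either sign: this is what makes every nonzero label of P lie in ±Σ(P),
-- so that a map defined on ±Σ(P) can be applied to the tiles of P.
_∈Σ_ : ℤ → Pot → Set
i ∈Σ P = Positive i × Any (λ t → i ∈ t ⊎ - i ∈ t) P

_∈±Σ_ : ℤ → Pot → Set
i ∈±Σ P = i ∈Σ P ⊎ - i ∈Σ P

-- Membership proofs are irrelevant here, so _≡_ on ±Σ P is equality of the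
-- underlying integers.
±Σ : Pot → Set
±Σ P = Refinement ℤ (_∈±Σ P)

neg : ∀ {P} → ±Σ P → ±Σ P
neg {P} = Refinement.map -_ closed
  where
  closed : ∀ {i} → i ∈±Σ P → - i ∈±Σ P
  closed {i} (inj₁ p) = inj₂ (subst (_∈Σ P) (sym (neg-involutive i)) p)
  closed     (inj₂ p) = inj₁ p

-- The multiset t′ is f(t), where f is applied elementwise with multiplicity.
-- The list u is t with its entries regarded as elements of ±Σ(P).
IsImage : ∀ {P P′} → (±Σ P → ±Σ P′) → Tile → Tile → Set
IsImage {P} f t t′ =
  Σ (List (±Σ P)) λ u → map value u ≡ t × map (λ i → value (f i)) u ↭ t′

-- f(P) = P′, as an equality of sets of tiles.
MapsOnto : ∀ P P′ → (±Σ P → ±Σ P′) → Set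
MapsOnto P P′ f =
    (∀ t  → t  ∈ᵖ P  → ∃ λ t′ → t′ ∈ᵖ P′ × IsImage f t t′)
  × (∀ t′ → t′ ∈ᵖ P′ → ∃ λ t  → t  ∈ᵖ P  × IsImage f t t′)

_≅_ : Pot → Pot → Set
P ≅ P′ = Σ (±Σ P ⤖ ±Σ P′) λ f → let open Bijection f in
  (∀ i → to (neg i) ≡ neg (to i)) × MapsOnto P P′ to

private instance
  ℤ-number : Number ℤ
  ℤ-number = ℤ.number

  ℤ-negative : Negative ℤ
  ℤ-negative = ℤ.negative

P₁ P₂ : Pot

P₁ = ( 1 ∷  1 ∷  1 ∷ [])
   ∷ ( 2 ∷  2 ∷  2 ∷ [])
   ∷ (-2 ∷ -3 ∷ -3 ∷ [])
   ∷ (-1 ∷ -4 ∷ -4 ∷ [])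
   ∷ (-1 ∷  3 ∷ -5 ∷ [])
   ∷ (-2 ∷  4 ∷  5 ∷ [])
   ∷ []

P₂ = ( 1 ∷  1 ∷  1 ∷ [])
   ∷ ( 2 ∷  2 ∷  2 ∷ [])
   ∷ (-2 ∷ -3 ∷ -3 ∷ [])
   ∷ (-1 ∷ -4 ∷ -4 ∷ [])
   ∷ ( 3 ∷  4 ∷  5 ∷ [])
   ∷ (-1 ∷ -2 ∷ -5 ∷ [])
   ∷ []

{-# OPTIONS --safe #-}

-- An isomorphism sends 1 and 2 to elements a and d with {a,a,a} and {d,d,d} in
-- P₂, and sends -3 to some c with {-d,c,c} and {-a,-c,e} in P₂ for some e.
-- In P₂ the cubes force a, d ∈ {1,2}, so {-d,c,c} forces c ∈ {-3,-4}; but the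
-- only tile of P₂ with a label 3 or 4 is {3,4,5}, which does not contain -a.
module Submission where

open import Defs
open import Relation.Nullary using (¬_)

open import Data.Integer.Base using (ℤ; -_; +_; -[1+_])
open import Data.Integer.Properties using (_≟_)
open import Data.List.Base using ([]; _∷_; concat; map)
open import Data.List.Membership.DecPropositional _≟_ using (_∈_; _∈?_)
open import Data.List.Membership.Propositional.Properties using (∈-concat⁺)
open import Data.List.Properties using (map-injective)
open import Data.List.Relation.Binary.Permutation.Propositional using (↭-refl; ↭-sym; ↭-trans)
open import Data.List.Relation.Binary.Subset.DecPropositional _≟_ using (_⊆_; _⊆?_)
open import Data.List.Relation.Binary.Subset.Propositional.Properties using (⊆-reflexive-↭)
open import Data.List.Relation.Unary.All using (All; all?; lookup)
open import Data.List.Relation.Unary.Any as Any using (Any; any?; here; there)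
open import Data.Irrelevant using ([_])
open import Data.Product.Base using (_×_; _,_)
open import Data.Refinement using (_,_; value)
open import Data.Refinement.Properties using (value-injective)
open import Data.Sum.Base using (inj₁; inj₂)
open import Function.Bundles using (module Bijection)
open import Relation.Binary.PropositionalEquality using (_≡_; refl; sym; cong)
open import Relation.Nullary.Decidable using (Dec; from-yes; ¬?; _×-dec_; _→-dec_)

-- Equality of underlying sets is a decidable weakening of _∈ᵖ_, and multiplicities
-- play no role in distinguishing P₁ from P₂.
infix 4 _∈ˢ_ _∈ˢ?_

_∈ˢ_ : Tile → Pot → Set
t ∈ˢ P = Any (λ t′ → t ⊆ t′ × t′ ⊆ t) P

_∈ˢ?_ : ∀ t P → Dec (t ∈ˢ P)
t ∈ˢ? P = any? (λ t′ → t ⊆? t′ ×-dec t′ ⊆? t) P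

∈ᵖ⇒∈ˢ : ∀ {t P} → t ∈ᵖ P → t ∈ˢ P
∈ᵖ⇒∈ˢ = Any.map λ t↭t′ → ⊆-reflexive-↭ t↭t′ , ⊆-reflexive-↭ (↭-sym t↭t′)

∈ˢ⇒∈-concat : ∀ {i t P} → i ∈ t → t ∈ˢ P → i ∈ concat P
∈ˢ⇒∈-concat i∈t t∈P = ∈-concat⁺ (Any.map (λ (t⊆t′ , _) → t⊆t′ i∈t) t∈P)

-- `IsImage` supplies its own lift `v` of the tile to ±Σ(P). Membership proofs being irrelevant, a
-- lift is determined by its values, so `v` is `u`.
image∈ᵖ : ∀ {P P′} (f : ±Σ P → ±Σ P′) → MapsOnto P P′ f →
          ∀ u → map value u ∈ᵖ P → map (λ i → value (f i)) u ∈ᵖ P′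
image∈ᵖ f (into , _) u u∈P with into _ u∈P
... | t′ , t′∈P′ , v , v≡u , fv↭t′ with map-injective value-injective v≡u
... | refl = Any.map (↭-trans fv↭t′) t′∈P′

-- A finite check over the labels of `P₂`. Each hypothesis directly follows the quantifier it
-- restricts, which prunes the search; e is left out by asking only that one tile contain both -a
-- and -c.
P₂-avoids :
  All (λ d → d ∷ d ∷ d ∷ [] ∈ˢ P₂ →
    All (λ c → - d ∷ c ∷ c ∷ [] ∈ˢ P₂ →
      All (λ a → a ∷ a ∷ a ∷ [] ∈ˢ P₂ →
        ¬ Any (λ t → - a ∈ t × - c ∈ t) P₂)
      (concat P₂))
    (concat P₂))
  (concat P₂)
P₂-avoids = from-yes
  (all? (λ d → (d ∷ d ∷ d ∷ [] ∈ˢ? P₂) →-dec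
    all? (λ c → (- d ∷ c ∷ c ∷ [] ∈ˢ? P₂) →-dec
      all? (λ a → (a ∷ a ∷ a ∷ [] ∈ˢ? P₂) →-dec
        ¬? (any? (λ t → (- a ∈? t) ×-dec (- c ∈? t)) P₂))
      (concat P₂))
    (concat P₂))
  (concat P₂))

mainTheorem4 : ¬ (P₁ ≅ P₂)
mainTheorem4 (f , to-neg , onto) =
  lookup (lookup (lookup P₂-avoids (∈ˢ⇒∈-concat (here refl) ddd) ddd)
                 (∈ˢ⇒∈-concat (there (here refl)) dcc) dcc)
         (∈ˢ⇒∈-concat (here refl) aaa) aaa
         (Any.map (λ (s , _) → s (here refl) , s (there (here refl))) ace)
  where
  open Bijection f using (to)

  F : ±Σ P₁ → ℤ
  F i = value (to i)

  F-neg : ∀ i → F (neg i) ≡ - F i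
  F-neg i = cong value (to-neg i)

  one two minus-three minus-five : ±Σ P₁
  one         = + 1      , [ inj₁ (_ , here (inj₁ (here refl))) ]
  two         = + 2      , [ inj₁ (_ , there (here (inj₁ (here refl)))) ]
  -- The outer `inj₂` says that the opposite, 3 or 5, is a color; the inner one that this color is
  -- witnessed by a negative entry of a tile.
  minus-three = -[1+ 2 ] , [ inj₂ (_ , there (there (here (inj₂ (there (here refl)))))) ]
  minus-five  = -[1+ 4 ] , [ inj₂ (_ , there (there (there (there (here (inj₂ (there (there (here refl))))))))) ]

  image : ∀ u → map value u ∈ᵖ P₁ → map F u ∈ˢ P₂
  image u u∈P₁ = ∈ᵖ⇒∈ˢ (image∈ᵖ to onto u u∈P₁)

  aaa : F one ∷ F one ∷ F one ∷ [] ∈ˢ P₂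
  aaa = image (one ∷ one ∷ one ∷ []) (here ↭-refl)

  ddd : F two ∷ F two ∷ F two ∷ [] ∈ˢ P₂
  ddd = image (two ∷ two ∷ two ∷ []) (there (here ↭-refl))

  dcc : - F two ∷ F minus-three ∷ F minus-three ∷ [] ∈ˢ P₂
  dcc rewrite sym (F-neg two) =
    image (neg two ∷ minus-three ∷ minus-three ∷ []) (there (there (here ↭-refl)))

  ace : - F one ∷ - F minus-three ∷ F minus-five ∷ [] ∈ˢ P₂
  ace rewrite sym (F-neg one) | sym (F-neg minus-three) =
    image (neg one ∷ neg minus-three ∷ minus-five ∷ [])
          (there (there (there (there (here ↭-refl)))))
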